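{- For every set of formulas $\Phi\cup\{\psi\}\subseteq\mathcal L$: if $\Phi\models_{\mathsf{InqI}}\psi$, then $\Phi\vdash_{\mathsf{InqI}}\psi$.
   Context: Fix a set $\mathcal P$ of atomic sentences. The language $\mathcal L$ is given by $\varphi::=p\mid\bot\mid\varphi\land\varphi\mid\varphi\lor\varphi\mid\varphi\to\varphi\mid\varphi\sqcup\varphi$ with $p\in\mathcal P$, where $\lor$ is standard disjunction and $\sqcup$ denotes inquisitive disjunction. Standard formulas are those with no occurrence of $\sqcup$. An intuitionistic Kripke model is $M=\langle W,R,V\rangle$ with $W$ a set (of worlds), $R$ a partial order on $W$, and $V:W\times\mathcal P\to\{0,1\}$ such that $wRw'$ and $V(w,p)=1$ imply $V(w',p)=1$. A team is a set $t\subseteq W$; $R[w]=\{w'\mid wRw'\}$ and $R[t]=\bigcup_{w\in t}R[w]$. Support $M,t\models\varphi$ is defined by: - $M,t\models p$ iff $V(w,p)=1$ for all $w\in t$; - $M,t\models\bot$ iff $t=\emptyset$; - $M,t\models\varphi\land\psi$ iff $M,t\models\varphi$ and $M,t\models\psi$; - $M,t\models\varphi\lor\psi$ iff there are $t',t''$ with $t=t'\cup t''$, $M,t'\models\varphi$ and $M,t''\models\psi$; - $M,t\models\varphi\to\psi$ iff for all $t'\subseteq R[t]$, $M,t'\models\varphi$ implies $M,t'\models\psi$; - $M,t\models\varphi\sqcup\psi$ iff $M,t\models\varphi$ or $M,t\models\psi$. $\Phi\models_{\mathsf{InqI}}\psi$ means: for every intuitionistic Kripke model $M$ and team $t$ in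 $M$, if $M,t\models\varphi$ for all $\varphi\in\Phi$ then $M,t\models\psi$. $\Phi\vdash_{\mathsf{InqI}}\psi$ means that there is a natural deduction proof of $\psi$ from (finitely many) assumptions in $\Phi$ using the following rules, where $\varphi,\psi,\chi,\varphi',\psi'$ range over all formulas of $\mathcal L$ and $\alpha$ ranges only over standard formulas: - $(\land\mathsf i)$ from $\varphi$ and $\psi$ infer $\varphi\land\psi$; $(\land\mathsf e)$ from $\varphi\land\psi$ infer $\varphi$, and infer $\psi$; - $(\to\mathsf i)$ from a derivation of $\psi$ from assumption $\varphi$ infer $\varphi\to\psi$, discharging $\varphi$; $(\to\mathsf e)$ from $\varphi$ and $\varphi\to\psi$ infer $\psi$; - $(\sqcup\mathsf i)$ from $\varphi$ infer $\varphi\sqcup\psi$, and from $\psi$ infer $\varphi\sqcup\psi$; $(\sqcup\mathsf e)$ from $\varphi\sqcup\psi$, a derivation of $\chi$ from $\varphi$, and a derivation of $\chi$ from $\psi$, infer $\chi$, discharging $\varphi$ and $\psi$; - $(\lor\mathsf i)$ from $\varphi$ infer $\varphi\lor\psi$, and from $\psi$ infer $\varphi\lor\psi$; $(\lor\mathsf e)$ from $\varphi\lor\psi$, a derivation of $\alpha$ from $\varphi$, and a derivation of $\alpha$ from $\psi$, infer $\alpha$ ($\alpha$ standard), discharging $\varphi$ and $\psi$; - $(\lor\mathsf a)$ from $\varphi\lor(\psi\lor\chi)$ infer $(\varphi\lor\psi)\lor\chi$; $(\lor\mathsf c)$ from $\varphi\lor\psi$ infer $\psi\lor\varphi$; - $(\lor\mathsf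 r)$ from $\varphi\lor\psi$, a derivation of $\varphi'$ from $\varphi$, and a derivation of $\psi'$ from $\psi$, infer $\varphi'\lor\psi'$, discharging $\varphi$ and $\psi$; - $(\lor\mathsf d)$ from $\varphi\lor(\psi\sqcup\chi)$ infer $(\varphi\lor\psi)\sqcup(\varphi\lor\chi)$; - $(\bot\mathsf e)$ from $\bot$ infer $\varphi$; - $(\mathsf S)$ from $\alpha\to(\varphi\sqcup\psi)$ infer $(\alpha\to\varphi)\sqcup(\alpha\to\psi)$ ($\alpha$ standard). -}

module Defs where

open import Data.Bool.Base using (Bool; true)
open import Data.List.Base using (List; []; _∷_)
open import Data.List.Membership.Propositional using () renaming (_∈_ to _∈ᴸ_)
open import Data.List.Relation.Unary.All using (All)
open import Data.Product.Base using (_×_; ∃; ∃-syntax)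
open import Data.Sum.Base using (_⊎_)
open import Level using (Level; 0ℓ; Lift) renaming (suc to lsuc)
open import Relation.Binary.Bundles using (Poset)
open import Relation.Binary.Core using (Rel)
open import Relation.Binary.PropositionalEquality.Core using (_≡_)
open import Relation.Binary.Structures using (IsPartialOrder)
open import Relation.Unary using (Pred; _∈_; _⊆_; _≐_; _∪_; Empty)

-- The empty chain is included, so the hypothesis makes the poset inhabited.
ZornsLemma : ∀ ℓ → Set (lsuc ℓ)
ZornsLemma ℓ = (X : Poset ℓ ℓ ℓ) → let open Poset X in
  ((C : Pred Carrier ℓ) →
     (∀ {x y} → x ∈ C → y ∈ C → x ≤ y ⊎ y ≤ x) →
     ∃[ u ] (∀ {x} → x ∈ C → x ≤ u)) →
  ∃[ m ] (∀ {x} → m ≤ x → m ≈ x)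

infixr 7 _∧_
infixr 6 _∨_ _⩖_
infixr 5 _⇒_

-- _∨_ is the standard (tensor) disjunction, _⩖_ the inquisitive one.
data Formula (P : Set) : Set where
  atom            : P → Formula P
  ⊥′              : Formula P
  _∧_ _∨_ _⇒_ _⩖_ : Formula P → Formula P → Formula P

data Standard {P : Set} : Formula P → Set where
  atom : ∀ p → Standard (atom p)
  ⊥′   : Standard ⊥′
  _∧_  : ∀ {α β} → Standard α → Standard β → Standard (α ∧ β)
  _∨_  : ∀ {α β} → Standard α → Standard β → Standard (α ∨ β)
  _⇒_  : ∀ {α β} → Standard α → Standard β → Standard (α ⇒ β)

record Model (P : Set) : Set₁ where
  field
    W              : Set
    R              : Rel W 0ℓ
    isPartialOrder : IsPartialOrder _≡_ R
    V              : W → P → Bool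
    persistent     : ∀ {w w′ p} → R w w′ → V w p ≡ true → V w′ p ≡ true

  Team : Set₁
  Team = Pred W 0ℓ

  R[_] : Team → Team
  R[ t ] w′ = ∃[ w ] (w ∈ t × R w w′)

infix 3 _,_⊨_ _⊨_ _⊢ᴸ_ _⊢_

-- Support quantifies over teams in the ∨ and ⇒ clauses, hence lives in Set₁;
-- Lift only adjusts the level of the atomic and ⊥′ clauses.
_,_⊨_ : {P : Set} (M : Model P) → Model.Team M → Formula P → Set₁
M , t ⊨ atom p = Lift (lsuc 0ℓ) (∀ {w} → w ∈ t → Model.V M w p ≡ true)
M , t ⊨ ⊥′     = Lift (lsuc 0ℓ) (Empty t)
M , t ⊨ φ ∧ ψ  = (M , t ⊨ φ) × (M , t ⊨ ψ)
M , t ⊨ φ ∨ ψ  = ∃[ t′ ] ∃[ t″ ] (t ≐ t′ ∪ t″ × (M , t′ ⊨ φ) × (M , t″ ⊨ ψ))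
M , t ⊨ φ ⇒ ψ  = ∀ t′ → t′ ⊆ Model.R[_] M t → M , t′ ⊨ φ → M , t′ ⊨ ψ
M , t ⊨ φ ⩖ ψ  = (M , t ⊨ φ) ⊎ (M , t ⊨ ψ)

_⊨_ : {P : Set} → Pred (Formula P) 0ℓ → Formula P → Set₁
_⊨_ {P} Φ ψ = (M : Model P) (t : Model.Team M) →
              (∀ {φ} → φ ∈ Φ → M , t ⊨ φ) → M , t ⊨ ψ

-- Γ ⊢ᴸ ψ: natural deduction proofs of ψ whose undischarged assumptions are
-- among the members of the list Γ.
data _⊢ᴸ_ {P : Set} (Γ : List (Formula P)) : Formula P → Set where
  hyp : ∀ {φ} → φ ∈ᴸ Γ → Γ ⊢ᴸ φ
  ∧i  : ∀ {φ ψ} → Γ ⊢ᴸ φ → Γ ⊢ᴸ ψ → Γ ⊢ᴸ φ ∧ ψ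
  ∧e₁ : ∀ {φ ψ} → Γ ⊢ᴸ φ ∧ ψ → Γ ⊢ᴸ φ
  ∧e₂ : ∀ {φ ψ} → Γ ⊢ᴸ φ ∧ ψ → Γ ⊢ᴸ ψ
  ⇒i  : ∀ {φ ψ} → φ ∷ Γ ⊢ᴸ ψ → Γ ⊢ᴸ φ ⇒ ψ
  ⇒e  : ∀ {φ ψ} → Γ ⊢ᴸ φ → Γ ⊢ᴸ φ ⇒ ψ → Γ ⊢ᴸ ψ
  ⩖i₁ : ∀ {φ ψ} → Γ ⊢ᴸ φ → Γ ⊢ᴸ φ ⩖ ψ
  ⩖i₂ : ∀ {φ ψ} → Γ ⊢ᴸ ψ → Γ ⊢ᴸ φ ⩖ ψ
  ⩖e  : ∀ {φ ψ χ} → Γ ⊢ᴸ φ ⩖ ψ → φ ∷ Γ ⊢ᴸ χ → ψ ∷ Γ ⊢ᴸ χ → Γ ⊢ᴸ χ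
  ∨i₁ : ∀ {φ ψ} → Γ ⊢ᴸ φ → Γ ⊢ᴸ φ ∨ ψ
  ∨i₂ : ∀ {φ ψ} → Γ ⊢ᴸ ψ → Γ ⊢ᴸ φ ∨ ψ
  ∨e  : ∀ {φ ψ α} → Standard α →
        Γ ⊢ᴸ φ ∨ ψ → φ ∷ Γ ⊢ᴸ α → ψ ∷ Γ ⊢ᴸ α → Γ ⊢ᴸ α
  ∨a  : ∀ {φ ψ χ} → Γ ⊢ᴸ φ ∨ (ψ ∨ χ) → Γ ⊢ᴸ (φ ∨ ψ) ∨ χ
  ∨c  : ∀ {φ ψ} → Γ ⊢ᴸ φ ∨ ψ → Γ ⊢ᴸ ψ ∨ φ
  ∨r  : ∀ {φ ψ φ′ ψ′} →
        Γ ⊢ᴸ φ ∨ ψ → φ ∷ Γ ⊢ᴸ φ′ → ψ ∷ Γ ⊢ᴸ ψ′ → Γ ⊢ᴸ φ′ ∨ ψ′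
  ∨d  : ∀ {φ ψ χ} → Γ ⊢ᴸ φ ∨ (ψ ⩖ χ) → Γ ⊢ᴸ (φ ∨ ψ) ⩖ (φ ∨ χ)
  ⊥e  : ∀ {φ} → Γ ⊢ᴸ ⊥′ → Γ ⊢ᴸ φ
  S   : ∀ {α φ ψ} → Standard α →
        Γ ⊢ᴸ α ⇒ (φ ⩖ ψ) → Γ ⊢ᴸ (α ⇒ φ) ⩖ (α ⇒ ψ)

_⊢_ : {P : Set} → Pred (Formula P) 0ℓ → Formula P → Set
Φ ⊢ ψ = ∃[ Γ ] (All (_∈ Φ) Γ × (Γ ⊢ᴸ ψ))

{-# OPTIONS --safe #-}
-- Every formula is equivalent, both provably and in the canonical model, to an
-- inquisitive disjunction of standard formulas.  The worlds of the canonical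
-- model are the consistent prime theories, and a standard formula is supported
-- by a team exactly when it belongs to every world of the team.  If Φ ⊬ ψ, let
-- Θ ⊇ Φ be maximal among the sets not deriving ψ.  Then Θ is closed under
-- deduction and prime for ⩖, so by the normal form the team of all worlds
-- extending Θ supports exactly the members of Θ: all of Φ, but not ψ.
module Submission where

open import Defs
open import Axiom.ExcludedMiddle using (ExcludedMiddle)
open import Data.Bool.Base using (Bool; true)
open import Data.Empty using (⊥-elim)
open import Data.List.Base using (List; []; _∷_; _++_)
open import Data.List.Relation.Binary.Subset.Propositional using () renaming (_⊆_ to _⊆ᴸ_)
open import Data.List.Relation.Binary.Subset.Propositional.Properties
  using (∷⁺ʳ; xs⊆x∷xs; xs⊆xs++ys; xs⊆ys++xs)
open import Data.List.Relation.Unary.All using (All; []; _∷_)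
import Data.List.Relation.Unary.All as All
open import Data.List.Relation.Unary.All.Properties using (++⁺)
open import Data.List.Relation.Unary.Any using (here; there)
open import Data.Product.Base using (_×_; _,_; ∃-syntax; proj₁; proj₂; swap)
open import Data.Sum.Base as Sum using (_⊎_; inj₁; inj₂)
open import Function.Base using (_∘_; id)
open import Level using (0ℓ; lift; lower; Lift) renaming (suc to lsuc)
open import Relation.Binary.Bundles using (Poset)
open import Relation.Binary.PropositionalEquality
  using (_≡_; refl; sym; isEquivalence)
open import Relation.Nullary using (¬_; Dec; yes; no; does)
open import Relation.Nullary.Decidable using (dec-true; map′)
open import Relation.Unary using (Pred; _∈_; _∉_; _⊆_; _∪_; _∩_)

-- Structural properties of derivability.

weaken : ∀ {P} {Γ Δ : List (Formula P)} {φ} → Γ ⊆ᴸ Δ → Γ ⊢ᴸ φ → Δ ⊢ᴸ φ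
weaken s (hyp x)     = hyp (s x)
weaken s (∧i d e)    = ∧i (weaken s d) (weaken s e)
weaken s (∧e₁ d)     = ∧e₁ (weaken s d)
weaken s (∧e₂ d)     = ∧e₂ (weaken s d)
weaken s (⇒i d)      = ⇒i (weaken (∷⁺ʳ _ s) d)
weaken s (⇒e d e)    = ⇒e (weaken s d) (weaken s e)
weaken s (⩖i₁ d)     = ⩖i₁ (weaken s d)
weaken s (⩖i₂ d)     = ⩖i₂ (weaken s d)
weaken s (⩖e d e f)  = ⩖e (weaken s d) (weaken (∷⁺ʳ _ s) e) (weaken (∷⁺ʳ _ s) f)
weaken s (∨i₁ d)     = ∨i₁ (weaken s d)
weaken s (∨i₂ d)     = ∨i₂ (weaken s d)
weaken s (∨e a d e f) = ∨e a (weaken s d) (weaken (∷⁺ʳ _ s) e) (weaken (∷⁺ʳ _ s) f)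
weaken s (∨a d)      = ∨a (weaken s d)
weaken s (∨c d)      = ∨c (weaken s d)
weaken s (∨r d e f)  = ∨r (weaken s d) (weaken (∷⁺ʳ _ s) e) (weaken (∷⁺ʳ _ s) f)
weaken s (∨d d)      = ∨d (weaken s d)
weaken s (⊥e d)      = ⊥e (weaken s d)
weaken s (S a d)     = S a (weaken s d)

weaken₁ : ∀ {P} {Γ : List (Formula P)} {φ χ} → Γ ⊢ᴸ φ → χ ∷ Γ ⊢ᴸ φ
weaken₁ = weaken (xs⊆x∷xs _ _)

pattern #0 = here refl
pattern #1 = there #0
pattern #2 = there #1

⊢-mono : ∀ {P} {Φ Ψ : Pred (Formula P) 0ℓ} {φ} → Φ ⊆ Ψ → Φ ⊢ φ → Ψ ⊢ φ
⊢-mono s (Γ , Γ⊆Φ , d) = Γ , All.map s Γ⊆Φ , d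

⊢-mp : ∀ {P} {Φ : Pred (Formula P) 0ℓ} {φ ψ} → Φ ⊢ φ → Φ ⊢ φ ⇒ ψ → Φ ⊢ ψ
⊢-mp (Γ , Γ⊆Φ , d) (Δ , Δ⊆Φ , e) =
  Γ ++ Δ , ++⁺ Γ⊆Φ Δ⊆Φ , ⇒e (weaken (xs⊆xs++ys Γ Δ) d) (weaken (xs⊆ys++xs Δ Γ) e)

deduction : ∀ {P} {Φ : Pred (Formula P) 0ℓ} {φ ψ} →
            (Φ ∪ (_≡ φ)) ⊢ ψ → Φ ⊢ φ ⇒ ψ
deduction {Φ = Φ} {φ} (Γ , Γ⊆ , d) with separate Γ⊆
  where
  -- Assumptions from `Φ` are kept, and all occurrences of `φ` are merged into the single head of
  -- `φ ∷ Δ`, ready to be discharged.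
  separate : ∀ {Γ} → All (_∈ Φ ∪ (_≡ φ)) Γ → ∃[ Δ ] (All (_∈ Φ) Δ × Γ ⊆ᴸ φ ∷ Δ)
  separate [] = [] , [] , λ ()
  separate (p ∷ ps) with separate ps
  separate (inj₁ χ∈Φ ∷ ps) | Δ , Δ⊆Φ , s = _ ∷ Δ , χ∈Φ ∷ Δ⊆Φ , λ
    { #0 → #1
    ; (there x) → ∷⁺ʳ φ (xs⊆x∷xs Δ _) (s x) }
  separate (inj₂ refl ∷ ps) | Δ , Δ⊆Φ , s = Δ , Δ⊆Φ , λ
    { #0 → #0
    ; (there x) → s x }
... | Δ , Δ⊆Φ , s = Δ , Δ⊆Φ , ⇒i (weaken s d)

does-true : {A : Set} (a? : Dec A) → does a? ≡ true → A
does-true (yes a) _ = a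

data Disjunction {P : Set} : Formula P → Set where
  std : ∀ {α} → Standard α → Disjunction α
  _⩖_ : ∀ {φ ψ} → Disjunction φ → Disjunction ψ → Disjunction (φ ⩖ ψ)

persistence : ∀ {P} (M : Model P) φ {t t′} → t′ ⊆ t → _,_⊨_ M t φ → _,_⊨_ M t′ φ
persistence M (atom p) s (lift h) = lift (h ∘ s)
persistence M ⊥′ s (lift h) = lift (λ w → h w ∘ s)
persistence M (φ ∧ ψ) s (h , k) = persistence M φ s h , persistence M ψ s k
persistence M (φ ∨ ψ) {t} {t′} s (u , v , (t⊆ , _) , h , k) =
  t′ ∩ u , t′ ∩ v
  , ( (λ x → Sum.map (x ,_) (x ,_) (t⊆ (s x)))
    , λ { (inj₁ (x , _)) → x ; (inj₂ (x , _)) → x } )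
  , persistence M φ proj₂ h , persistence M ψ proj₂ k
persistence M (φ ⇒ ψ) s h t′ t′⊆ = h t′ λ x → let (w , w∈ , r) = t′⊆ x in w , s w∈ , r
persistence M (φ ⩖ ψ) s = Sum.map (persistence M φ s) (persistence M ψ s)

-- Theories and the Lindenbaum lemma.

module Canonical (em : ExcludedMiddle (lsuc 0ℓ)) (zorn : ZornsLemma 0ℓ) (P : Set) where

  em₀ : (A : Set) → Dec A
  em₀ A = map′ lower lift (em {Lift (lsuc 0ℓ) A})

  by-contradiction : {A : Set} → ¬ ¬ A → A
  by-contradiction {A} ¬¬a with em₀ A
  ... | yes a = a
  ... | no ¬a = ⊥-elim (¬¬a ¬a)

  -- Worlds must form a small type, so theories are Bool-valued.
  Theory : Set
  Theory = Formula P → Bool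

  ⟦_⟧ : Theory → Pred (Formula P) 0ℓ
  ⟦ u ⟧ φ = u φ ≡ true

  theory : Pred (Formula P) 0ℓ → Theory
  theory Φ φ = does (em₀ (Φ φ))

  theory⁺ : ∀ Φ → Φ ⊆ ⟦ theory Φ ⟧
  theory⁺ Φ {φ} = dec-true (em₀ (Φ φ))

  theory⁻ : ∀ Φ → ⟦ theory Φ ⟧ ⊆ Φ
  theory⁻ Φ {φ} = does-true (em₀ (Φ φ))

  Closed : Theory → Set
  Closed u = ∀ {φ} → ⟦ u ⟧ ⊢ φ → φ ∈ ⟦ u ⟧

  -- The field `maximal` is maximality internalised by the deduction theorem: adding any missing `χ`
  -- would make `ψ` derivable.
  record MaximalOmitting (ψ : Formula P) (u : Theory) : Set where
    field
      closed  : Closed u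
      omits   : ψ ∉ ⟦ u ⟧
      maximal : ∀ {χ} → χ ∉ ⟦ u ⟧ → (χ ⇒ ψ) ∈ ⟦ u ⟧

    -- If both disjuncts were missing, each would imply `ψ` by maximality, and `⩖e` would put `ψ`
    -- into `u`.
    ⩖-prime : ∀ {φ χ} → (φ ⩖ χ) ∈ ⟦ u ⟧ → φ ∈ ⟦ u ⟧ ⊎ χ ∈ ⟦ u ⟧
    ⩖-prime {φ} {χ} d with em₀ (φ ∈ ⟦ u ⟧) | em₀ (χ ∈ ⟦ u ⟧)
    ... | yes p | _     = inj₁ p
    ... | no _  | yes q = inj₂ q
    ... | no ¬p | no ¬q = ⊥-elim (omits (closed
      ( _ , d ∷ maximal ¬p ∷ maximal ¬q ∷ []
      , ⩖e (hyp #0) (⇒e (hyp #0) (hyp #2)) (⇒e (hyp #0) (hyp (there #2))))))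

    -- The same argument with `∨e`, whose conclusion must be standard; hence the condition on `ψ`.
    ∨-prime : Standard ψ → ∀ {φ χ} → (φ ∨ χ) ∈ ⟦ u ⟧ → φ ∈ ⟦ u ⟧ ⊎ χ ∈ ⟦ u ⟧
    ∨-prime σ {φ} {χ} d with em₀ (φ ∈ ⟦ u ⟧) | em₀ (χ ∈ ⟦ u ⟧)
    ... | yes p | _     = inj₁ p
    ... | no _  | yes q = inj₂ q
    ... | no ¬p | no ¬q = ⊥-elim (omits (closed
      ( _ , d ∷ maximal ¬p ∷ maximal ¬q ∷ []
      , ∨e σ (hyp #0) (⇒e (hyp #0) (hyp #2)) (⇒e (hyp #0) (hyp (there #2))))))

    consistent : ⊥′ ∉ ⟦ u ⟧
    consistent b = omits (closed (_ , b ∷ [] , ⊥e (hyp #0)))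

  module Extension (Φ : Pred (Formula P) 0ℓ) (ψ : Formula P) (Φ⊬ψ : ¬ (Φ ⊢ ψ)) where

    Candidate : Set
    Candidate = ∃[ u ] (Φ ⊆ ⟦ u ⟧ × ¬ (⟦ u ⟧ ⊢ ψ))

    candidates : Poset 0ℓ 0ℓ 0ℓ
    candidates = record
      { Carrier = Candidate
      ; _≈_ = λ (u , _) (v , _) → (⟦ u ⟧ ⊆ ⟦ v ⟧) × (⟦ v ⟧ ⊆ ⟦ u ⟧)
      ; _≤_ = λ (u , _) (v , _) → ⟦ u ⟧ ⊆ ⟦ v ⟧
      ; isPartialOrder = record
        { isPreorder = record
          { isEquivalence = record
            { refl  = id , id
            ; sym   = swap
            ; trans = λ (f , g) (h , k) → (λ x → h (f x)) , (λ x → g (k x)) }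
          ; reflexive = λ p → proj₁ p
          ; trans = λ f g x → g (f x) }
        ; antisym = λ f g → f , g } }
    open Poset candidates using (_≤_)

    base : Candidate
    base = theory Φ , theory⁺ Φ , λ d → Φ⊬ψ (⊢-mono (theory⁻ Φ) d)

    chain-bounded : (C : Pred Candidate 0ℓ) →
      (∀ {x y} → x ∈ C → y ∈ C → x ≤ y ⊎ y ≤ x) →
      ∃[ u ] (∀ {x} → x ∈ C → x ≤ u)
    chain-bounded C chain =
      ( theory ⋃C
      , (λ φ∈Φ → theory⁺ ⋃C (base , inj₁ refl , theory⁺ Φ φ∈Φ))
      , λ d → let (_ , Γ⊆ , e) = ⊢-mono (theory⁻ ⋃C) d
                  (c , _ , Γ⊆c) = finite Γ⊆
              in proj₂ (proj₂ c) (_ , Γ⊆c , e) )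
      , λ c∈C φ∈c → theory⁺ ⋃C (_ , inj₂ c∈C , φ∈c)
      where
      -- The chain may be empty, so `base` is adjoined; it lies below every candidate, so the result
      -- is still a chain.
      C⁺ : Pred Candidate 0ℓ
      C⁺ = (_≡ base) ∪ C

      ⋃C : Pred (Formula P) 0ℓ
      ⋃C φ = ∃[ c ] (c ∈ C⁺ × φ ∈ ⟦ proj₁ c ⟧)

      chain⁺ : ∀ {x y} → x ∈ C⁺ → y ∈ C⁺ → x ≤ y ⊎ y ≤ x
      chain⁺ {y = y} (inj₁ refl) _ = inj₁ λ p → proj₁ (proj₂ y) (theory⁻ Φ p)
      chain⁺ {x = x} (inj₂ _) (inj₁ refl) = inj₂ λ p → proj₁ (proj₂ x) (theory⁻ Φ p)
      chain⁺ (inj₂ p) (inj₂ q) = chain p q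

      -- A derivation uses finitely many assumptions, so all of them already lie in one member of
      -- the chain, which does not derive `ψ`.
      finite : ∀ {Γ} → All (_∈ ⋃C) Γ → ∃[ c ] (c ∈ C⁺ × All (_∈ ⟦ proj₁ c ⟧) Γ)
      finite [] = base , inj₁ refl , []
      finite ((c , c∈ , p) ∷ ps) with finite ps
      ... | d , d∈ , qs with chain⁺ c∈ d∈
      ...   | inj₁ c≤d = d , d∈ , c≤d p ∷ qs
      ...   | inj₂ d≤c = c , c∈ , p ∷ All.map d≤c qs

    abstract
      lindenbaum : ∃[ u ] (Φ ⊆ ⟦ u ⟧ × MaximalOmitting ψ u)
      lindenbaum with zorn candidates chain-bounded
      ... | (u , Φ⊆u , u⊬ψ) , max = u , Φ⊆u , record
        { closed  = cl
        ; omits   = λ p → u⊬ψ (_ , p ∷ [] , hyp #0)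
        ; maximal = λ χ∉u → cl (extend χ∉u) }
        where
        extend : ∀ {χ} → χ ∉ ⟦ u ⟧ → ⟦ u ⟧ ⊢ χ ⇒ ψ
        -- If `χ ⇒ ψ` were not derivable, `u+χ` would be a candidate above `u`, and maximality would
        -- force `χ` into `u`.
        extend {χ} χ∉u = by-contradiction λ u⊬χ⇒ψ →
          χ∉u (proj₂ (max {theory u+χ
                          , (λ p → theory⁺ u+χ (inj₁ (Φ⊆u p)))
                          , λ d → u⊬χ⇒ψ (deduction (⊢-mono (theory⁻ u+χ) d))}
                          (λ p → theory⁺ u+χ (inj₁ p)))
                     (theory⁺ u+χ (inj₂ refl)))
          where
          u+χ : Pred (Formula P) 0ℓ
          u+χ = ⟦ u ⟧ ∪ (_≡ χ)

        cl : Closed u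
        cl d = by-contradiction λ φ∉u → u⊬ψ (⊢-mp d (extend φ∉u))

  open Extension using (lindenbaum)

  -- The canonical model.

  record World : Set where
    field
      mem        : Theory
      closed     : Closed mem
      consistent : ⊥′ ∉ ⟦ mem ⟧
      prime      : ∀ {φ χ} → (φ ∨ χ) ∈ ⟦ mem ⟧ → φ ∈ ⟦ mem ⟧ ⊎ χ ∈ ⟦ mem ⟧

  infix 4 _∋_
  _∋_ : World → Formula P → Set
  w ∋ φ = φ ∈ ⟦ World.mem w ⟧

  -- For standard `β`, a maximal set omitting `β` is prime for `∨`, hence a world.
  separating-world : ∀ {Φ β} → Standard β → ¬ (Φ ⊢ β) →
                     ∃[ w ] ((∀ {φ} → φ ∈ Φ → w ∋ φ) × ¬ (w ∋ β))
  separating-world σ Φ⊬β with lindenbaum _ _ Φ⊬β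
  ... | u , Φ⊆u , m = record
    { mem = u ; closed = closed ; consistent = consistent ; prime = ∨-prime σ }
    , Φ⊆u , omits
    where open MaximalOmitting m

  -- Distinct worlds may have the same members (there is no function
  -- extensionality), so inclusion is only a preorder.  Antisymmetry with respect
  -- to _≡_ is obtained by dropping the edges between distinct such worlds.
  _⊑_ : World → World → Set
  w ⊑ v = w ≡ v ⊎ ((∀ {φ} → w ∋ φ → v ∋ φ) × ¬ (∀ {φ} → v ∋ φ → w ∋ φ))

  ⊑⇒⊆ : ∀ {w v φ} → w ⊑ v → w ∋ φ → v ∋ φ
  ⊑⇒⊆ (inj₁ refl)    p = p
  ⊑⇒⊆ (inj₂ (s , _)) p = s p

  ⊑-trans : ∀ {u v w} → u ⊑ v → v ⊑ w → u ⊑ w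
  ⊑-trans (inj₁ refl) r = r
  ⊑-trans r (inj₁ refl) = r
  ⊑-trans (inj₂ (s , ¬s)) (inj₂ (r , _)) =
    inj₂ ((λ p → r (s p)) , λ k → ¬s λ p → k (r p))

  ⊑-antisym : ∀ {w v} → w ⊑ v → v ⊑ w → w ≡ v
  ⊑-antisym (inj₁ eq) _ = eq
  ⊑-antisym (inj₂ _) (inj₁ eq) = sym eq
  ⊑-antisym (inj₂ (_ , ¬s)) (inj₂ (s , _)) = ⊥-elim (¬s s)

  M : Model P
  M = record
    { W = World
    ; R = _⊑_
    ; isPartialOrder = record
      { isPreorder = record
        { isEquivalence = isEquivalence ; reflexive = inj₁ ; trans = ⊑-trans }
      ; antisym = ⊑-antisym }
    ; V = λ w p → World.mem w (atom p)
    ; persistent = ⊑⇒⊆ }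

  open Model M using (Team; R[_])

  infix 3 _⊩_
  _⊩_ : Team → Formula P → Set₁
  t ⊩ φ = _,_⊨_ M t φ

  ⇒-separating-world : ∀ {w α β} → Standard β → ¬ (w ∋ α ⇒ β) →
                       ∃[ v ] (w ⊑ v × v ∋ α × ¬ (v ∋ β))
  ⇒-separating-world {w} {α} σ ∌
    with separating-world {⟦ World.mem w ⟧ ∪ (_≡ α)} σ (λ d → ∌ (World.closed w (deduction d)))
  ... | v , s , v∌β with em₀ (∀ {φ} → v ∋ φ → w ∋ φ)
  -- Here `v` and `w` have the same members but may be distinct and unrelated, so `w` itself serves
  -- as the witness.
  ...   | yes v⊆w = w , inj₁ refl , v⊆w (s (inj₂ refl)) , λ w∋β → v∌β (s (inj₁ w∋β))
  ...   | no  v⊈w = v , inj₂ ((λ p → s (inj₁ p)) , v⊈w) , s (inj₂ refl) , v∌β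

  -- Truth lemma for standard formulas.

  ⊩⇒∋ : ∀ {α t} → Standard α → t ⊩ α → ∀ {w} → w ∈ t → w ∋ α
  -- The implication case of either direction applies the other one to the antecedent, so both are
  -- proved by mutual induction.
  ∋⇒⊩ : ∀ {α t} → Standard α → (∀ {w} → w ∈ t → w ∋ α) → t ⊩ α

  ⊩⇒∋ (atom p) (lift h) w∈t = h w∈t
  ⊩⇒∋ ⊥′ (lift h) w∈t = ⊥-elim (h _ w∈t)
  ⊩⇒∋ (σ ∧ τ) (h , k) {w} w∈t =
    World.closed w (_ , ⊩⇒∋ σ h w∈t ∷ ⊩⇒∋ τ k w∈t ∷ [] , ∧i (hyp #0) (hyp #1))
  ⊩⇒∋ (σ ∨ τ) (t₁ , t₂ , (t⊆ , _) , h , k) {w} w∈t with t⊆ w∈t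
  ... | inj₁ x = World.closed w (_ , ⊩⇒∋ σ h x ∷ [] , ∨i₁ (hyp #0))
  ... | inj₂ x = World.closed w (_ , ⊩⇒∋ τ k x ∷ [] , ∨i₂ (hyp #0))
  ⊩⇒∋ (σ ⇒ τ) h {w} w∈t = by-contradiction λ ∌ →
    let (v , w⊑v , v∋α , v∌β) = ⇒-separating-world {w} τ ∌
    -- The singleton team of `v` lies in `R[ t ]` and supports the antecedent, so it must support
    -- the consequent.
    in v∌β (⊩⇒∋ τ (h (_≡ v) (λ { refl → w , w∈t , w⊑v })
                     (∋⇒⊩ σ λ { refl → v∋α })) refl)

  ∋⇒⊩ (atom p) h = lift h
  ∋⇒⊩ ⊥′ h = lift λ w w∈t → World.consistent w (h w∈t)
  ∋⇒⊩ (σ ∧ τ) h =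
    ∋⇒⊩ σ (λ {w} w∈t → World.closed w (_ , h w∈t ∷ [] , ∧e₁ (hyp #0))) ,
    ∋⇒⊩ τ (λ {w} w∈t → World.closed w (_ , h w∈t ∷ [] , ∧e₂ (hyp #0)))
  ∋⇒⊩ {α ∨ β} {t} (σ ∨ τ) h =
    t ∩ (_∋ α) , t ∩ (_∋ β)
    , ( (λ {w} w∈t → Sum.map (w∈t ,_) (w∈t ,_) (World.prime w (h w∈t)))
      , λ { (inj₁ (x , _)) → x ; (inj₂ (x , _)) → x } )
    , ∋⇒⊩ σ proj₂ , ∋⇒⊩ τ proj₂
  ∋⇒⊩ (σ ⇒ τ) h t′ t′⊆ k = ∋⇒⊩ τ λ {v} v∈t′ →
    let (w , w∈t , w⊑v) = t′⊆ v∈t′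
    in World.closed v
         (_ , ⊩⇒∋ σ k v∈t′ ∷ ⊑⇒⊆ w⊑v (h w∈t) ∷ [] , ⇒e (hyp #0) (hyp #1))

  -- Equivalence, provable and in the canonical model.

  infix 4 _≼_ _≋_

  -- Both kinds of entailment are carried together, so that one normal form serves both. Quantifying
  -- `derive` over `Γ` allows its use under discharged assumptions.
  record _≼_ (φ ψ : Formula P) : Set₁ where
    constructor _&_
    field
      derive  : ∀ {Γ} → Γ ⊢ᴸ φ → Γ ⊢ᴸ ψ
      support : ∀ {t} → t ⊩ φ → t ⊩ ψ
  open _≼_

  _≋_ : Formula P → Formula P → Set₁
  φ ≋ ψ = φ ≼ ψ × ψ ≼ φ

  ≼-refl : ∀ {φ} → φ ≼ φ
  ≼-refl = id & id

  ≼-trans : ∀ {φ ψ χ} → φ ≼ ψ → ψ ≼ χ → φ ≼ χ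
  ≼-trans (f & f′) (g & g′) = (λ d → g (f d)) & (λ h → g′ (f′ h))

  ≋-trans : ∀ {φ ψ χ} → φ ≋ ψ → ψ ≋ χ → φ ≋ χ
  ≋-trans (a , b) (c , d) = ≼-trans a c , ≼-trans d b

  ∧-mono : ∀ {φ φ′ ψ ψ′} → φ ≼ φ′ → ψ ≼ ψ′ → φ ∧ ψ ≼ φ′ ∧ ψ′
  ∧-mono a b = (λ d → ∧i (derive a (∧e₁ d)) (derive b (∧e₂ d)))
             & λ (h , k) → support a h , support b k

  ∨-mono : ∀ {φ φ′ ψ ψ′} → φ ≼ φ′ → ψ ≼ ψ′ → φ ∨ ψ ≼ φ′ ∨ ψ′
  ∨-mono a b = (λ d → ∨r d (derive a (hyp #0)) (derive b (hyp #0)))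
             & λ (t₁ , t₂ , eq , h , k) → t₁ , t₂ , eq , support a h , support b k

  ⇒-mono : ∀ {φ φ′ ψ ψ′} → φ′ ≼ φ → ψ ≼ ψ′ → φ ⇒ ψ ≼ φ′ ⇒ ψ′
  ⇒-mono a b = (λ d → ⇒i (derive b (⇒e (derive a (hyp #0)) (weaken₁ d))))
             & λ h t′ s k → support b (h t′ s (support a k))

  ⩖-lub : ∀ {φ ψ χ} → φ ≼ χ → ψ ≼ χ → φ ⩖ ψ ≼ χ
  ⩖-lub a b = (λ d → ⩖e d (derive a (hyp #0)) (derive b (hyp #0)))
            & Sum.[ support a , support b ]

  ⩖-inl : ∀ {φ ψ} → φ ≼ φ ⩖ ψ
  ⩖-inl = ⩖i₁ & inj₁

  ⩖-inr : ∀ {φ ψ} → ψ ≼ φ ⩖ ψ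
  ⩖-inr = ⩖i₂ & inj₂

  ⩖-mono : ∀ {φ φ′ ψ ψ′} → φ ≼ φ′ → ψ ≼ ψ′ → φ ⩖ ψ ≼ φ′ ⩖ ψ′
  ⩖-mono a b = ⩖-lub (≼-trans a ⩖-inl) (≼-trans b ⩖-inr)

  ∧-comm : ∀ {φ ψ} → φ ∧ ψ ≼ ψ ∧ φ
  ∧-comm = (λ d → ∧i (∧e₂ d) (∧e₁ d)) & swap

  ∨-comm : ∀ {φ ψ} → φ ∨ ψ ≼ ψ ∨ φ
  ∨-comm = ∨c & λ (t₁ , t₂ , (s , r) , h , k) →
    t₂ , t₁ , ((λ x → Sum.swap (s x)) , (λ x → r (Sum.swap x))) , k , h

  ∧-distrib-⩖ : ∀ {φ ψ χ} → φ ∧ (ψ ⩖ χ) ≋ (φ ∧ ψ) ⩖ (φ ∧ χ)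
  ∧-distrib-⩖ =
    ( (λ d → ⩖e (∧e₂ d) (⩖i₁ (∧i (weaken₁ (∧e₁ d)) (hyp #0)))
                        (⩖i₂ (∧i (weaken₁ (∧e₁ d)) (hyp #0))))
    & λ (h , k) → Sum.map (h ,_) (h ,_) k )
    , ⩖-lub (∧-mono ≼-refl ⩖-inl) (∧-mono ≼-refl ⩖-inr)

  ∨-distrib-⩖ : ∀ {φ ψ χ} → φ ∨ (ψ ⩖ χ) ≋ (φ ∨ ψ) ⩖ (φ ∨ χ)
  ∨-distrib-⩖ =
    ( ∨d & λ { (t₁ , t₂ , eq , h , inj₁ k) → inj₁ (t₁ , t₂ , eq , h , k)
             ; (t₁ , t₂ , eq , h , inj₂ k) → inj₂ (t₁ , t₂ , eq , h , k) } )
    , ⩖-lub (∨-mono ≼-refl ⩖-inl) (∨-mono ≼-refl ⩖-inr)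

  ⩖-⇒ : ∀ {φ ψ χ} → (φ ⩖ ψ) ⇒ χ ≋ (φ ⇒ χ) ∧ (ψ ⇒ χ)
  ⩖-⇒ =
    ( (λ d → ∧i (derive (⇒-mono ⩖-inl ≼-refl) d) (derive (⇒-mono ⩖-inr ≼-refl) d))
    & λ h → (λ t′ s k → h t′ s (inj₁ k)) , (λ t′ s k → h t′ s (inj₂ k)) )
    , ( (λ d → ⇒i (⩖e (hyp #0)
          (⇒e (hyp #0) (weaken₁ (weaken₁ (∧e₁ d))))
          (⇒e (hyp #0) (weaken₁ (weaken₁ (∧e₂ d))))))
      & λ (h , k) t′ s → Sum.[ h t′ s , k t′ s ] )

  split : ∀ {α φ ψ} → Standard α → α ⇒ (φ ⩖ ψ) ≋ (α ⇒ φ) ⩖ (α ⇒ ψ)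
  split {α} {φ} {ψ} σ = (S σ & semantic)
    , ⩖-lub (⇒-mono ≼-refl ⩖-inl) (⇒-mono ≼-refl ⩖-inr)
    where
    -- The α-worlds of R[ t ] form the largest team there that supports α.
    semantic : ∀ {t} → t ⊩ α ⇒ (φ ⩖ ψ) → t ⊩ (α ⇒ φ) ⩖ (α ⇒ ψ)
    semantic {t} h = Sum.map (restrict φ) (restrict ψ)
      (h (R[ t ] ∩ (_∋ α)) proj₁ (∋⇒⊩ σ proj₂))
      where
      restrict : ∀ χ → R[ t ] ∩ (_∋ α) ⊩ χ → t ⊩ α ⇒ χ
      -- Every team in `R[ t ]` supporting `α` consists of worlds containing `α`, so it is part of
      -- the largest such team and inherits `χ`.
      restrict χ k t′ s l = persistence M χ (λ x → s x , ⊩⇒∋ σ l x) k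

  -- Disjunctive normal forms.

  NormalForm : Formula P → Set₁
  NormalForm φ = ∃[ χ ] (Disjunction χ × φ ≋ χ)

  nf-≋ : ∀ {φ ψ} → φ ≋ ψ → NormalForm ψ → NormalForm φ
  nf-≋ eq (χ , δ , eq′) = χ , δ , ≋-trans eq eq′

  nf-std : ∀ {α} → Standard α → NormalForm α
  nf-std σ = _ , std σ , ≼-refl , ≼-refl

  nf-⩖ : ∀ {φ ψ} → NormalForm φ → NormalForm ψ → NormalForm (φ ⩖ ψ)
  nf-⩖ (_ , δ , a , a′) (_ , ε , b , b′) = _ , δ ⩖ ε , ⩖-mono a b , ⩖-mono a′ b′

  -- The right argument is expanded first, by distributivity; a disjunction on the left is then
  -- brought to the right and back by commutativity.
  disj-∧ : ∀ {φ ψ} → Disjunction φ → Disjunction ψ → NormalForm (φ ∧ ψ)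
  disj-∧ δ (ε₁ ⩖ ε₂) = nf-≋ ∧-distrib-⩖ (nf-⩖ (disj-∧ δ ε₁) (disj-∧ δ ε₂))
  disj-∧ (std σ) (std τ) = nf-std (σ ∧ τ)
  disj-∧ (δ₁ ⩖ δ₂) (std τ) =
    nf-≋ (≋-trans (∧-comm , ∧-comm) (≋-trans ∧-distrib-⩖
           (⩖-mono ∧-comm ∧-comm , ⩖-mono ∧-comm ∧-comm)))
         (nf-⩖ (disj-∧ δ₁ (std τ)) (disj-∧ δ₂ (std τ)))

  disj-∨ : ∀ {φ ψ} → Disjunction φ → Disjunction ψ → NormalForm (φ ∨ ψ)
  disj-∨ δ (ε₁ ⩖ ε₂) = nf-≋ ∨-distrib-⩖ (nf-⩖ (disj-∨ δ ε₁) (disj-∨ δ ε₂))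
  disj-∨ (std σ) (std τ) = nf-std (σ ∨ τ)
  disj-∨ (δ₁ ⩖ δ₂) (std τ) =
    nf-≋ (≋-trans (∨-comm , ∨-comm) (≋-trans ∨-distrib-⩖
           (⩖-mono ∨-comm ∨-comm , ⩖-mono ∨-comm ∨-comm)))
         (nf-⩖ (disj-∨ δ₁ (std τ)) (disj-∨ δ₂ (std τ)))

  nf-∧ : ∀ {φ ψ} → NormalForm φ → NormalForm ψ → NormalForm (φ ∧ ψ)
  nf-∧ (_ , δ , a , a′) (_ , ε , b , b′) = nf-≋ (∧-mono a b , ∧-mono a′ b′) (disj-∧ δ ε)

  nf-∨ : ∀ {φ ψ} → NormalForm φ → NormalForm ψ → NormalForm (φ ∨ ψ)
  nf-∨ (_ , δ , a , a′) (_ , ε , b , b′) = nf-≋ (∨-mono a b , ∨-mono a′ b′) (disj-∨ δ ε)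

  -- The antecedent is decomposed first, into a conjunction of implications, because `split` moves
  -- `⩖` out of the consequent only over a standard antecedent.
  disj-⇒ : ∀ {φ ψ} → Disjunction φ → Disjunction ψ → NormalForm (φ ⇒ ψ)
  disj-⇒ (δ₁ ⩖ δ₂) ε = nf-≋ ⩖-⇒ (nf-∧ (disj-⇒ δ₁ ε) (disj-⇒ δ₂ ε))
  disj-⇒ (std σ) (std τ) = nf-std (σ ⇒ τ)
  disj-⇒ (std σ) (ε₁ ⩖ ε₂) = nf-≋ (split σ) (nf-⩖ (disj-⇒ (std σ) ε₁) (disj-⇒ (std σ) ε₂))

  nf-⇒ : ∀ {φ ψ} → NormalForm φ → NormalForm ψ → NormalForm (φ ⇒ ψ)
  nf-⇒ (_ , δ , a , a′) (_ , ε , b , b′) = nf-≋ (⇒-mono a′ b , ⇒-mono a b′) (disj-⇒ δ ε)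

  normalForm : ∀ φ → NormalForm φ
  normalForm (atom p) = nf-std (atom p)
  normalForm ⊥′       = nf-std ⊥′
  normalForm (φ ∧ ψ)  = nf-∧ (normalForm φ) (normalForm ψ)
  normalForm (φ ∨ ψ)  = nf-∨ (normalForm φ) (normalForm ψ)
  normalForm (φ ⇒ ψ)  = nf-⇒ (normalForm φ) (normalForm ψ)
  normalForm (φ ⩖ ψ)  = nf-⩖ (normalForm φ) (normalForm ψ)

  -- Truth lemma for the maximal theory, and completeness.

  module _ {u ψ} (m : MaximalOmitting ψ u) where
    open MaximalOmitting m

    extensions : Team
    extensions w = ∀ {φ} → φ ∈ ⟦ u ⟧ → w ∋ φ

    -- Primeness for `⩖` selects one disjunct for the whole team, as support requires.
    disj-∈⇒⊩ : ∀ {χ} → Disjunction χ → χ ∈ ⟦ u ⟧ → extensions ⊩ χ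
    disj-∈⇒⊩ (std σ) χ∈u = ∋⇒⊩ σ λ w∈ → w∈ χ∈u
    disj-∈⇒⊩ (δ ⩖ ε) χ∈u = Sum.map (disj-∈⇒⊩ δ) (disj-∈⇒⊩ ε) (⩖-prime χ∈u)

    disj-⊩⇒∈ : ∀ {χ} → Disjunction χ → extensions ⊩ χ → χ ∈ ⟦ u ⟧
    -- By closure, a standard formula missing from `u` is not derivable from it, so some world of
    -- the team omits it.
    disj-⊩⇒∈ (std σ) h = by-contradiction λ χ∉u →
      let (w , u⊆w , w∌χ) = separating-world {⟦ u ⟧} σ (χ∉u ∘ closed)
      in w∌χ (⊩⇒∋ σ h {w} u⊆w)
    disj-⊩⇒∈ (δ ⩖ ε) (inj₁ h) = closed (_ , disj-⊩⇒∈ δ h ∷ [] , ⩖i₁ (hyp #0))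
    disj-⊩⇒∈ (δ ⩖ ε) (inj₂ h) = closed (_ , disj-⊩⇒∈ ε h ∷ [] , ⩖i₂ (hyp #0))

    ∈⇒⊩ : ∀ φ → φ ∈ ⟦ u ⟧ → extensions ⊩ φ
    ∈⇒⊩ φ φ∈u =
      let (_ , δ , a , a′) = normalForm φ
      in support a′ (disj-∈⇒⊩ δ (closed (_ , φ∈u ∷ [] , derive a (hyp #0))))

    ⊩⇒∈ : ∀ φ → extensions ⊩ φ → φ ∈ ⟦ u ⟧
    ⊩⇒∈ φ h =
      let (_ , δ , a , a′) = normalForm φ
      in closed (_ , disj-⊩⇒∈ δ (support a h) ∷ [] , derive a′ (hyp #0))

  completeness : ∀ Φ ψ → Φ ⊨ ψ → Φ ⊢ ψ
  completeness Φ ψ Φ⊨ψ = by-contradiction λ Φ⊬ψ →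
    let (_ , Φ⊆u , m) = lindenbaum Φ ψ Φ⊬ψ
    in MaximalOmitting.omits m
         (⊩⇒∈ m ψ (Φ⊨ψ M (extensions m) λ {φ} φ∈Φ → ∈⇒⊩ m φ (Φ⊆u φ∈Φ)))

theorem4p21 : ExcludedMiddle (lsuc 0ℓ) → ZornsLemma 0ℓ →
    (P : Set) (Φ : Pred (Formula P) 0ℓ) (ψ : Formula P) →
    Φ ⊨ ψ → Φ ⊢ ψ
theorem4p21 em zorn = Canonical.completeness em zorn
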